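{- For every graph $G$, $\operatorname{box}(G)\le MFVC(G)+3$.
   Context: A feedback vertex cover of $G=(V,E)$ is a set $S\subseteq V$ such that the subgraph induced on $V\setminus S$ is a forest; $MFVC(G)$ is the minimum cardinality of a feedback vertex cover. The boxicity $\operatorname{box}(G)$ is the minimum $b$ such that $G$ is the intersection graph of axis-parallel boxes in $\mathbb{R}^b$ (products of $b$ closed intervals), one box per vertex. -}

module Defs where

open import Data.Fin.Base using (Fin; zero; suc; inject₁; fromℕ)
open import Data.Fin.Subset using (Subset; _∉_; ∣_∣)
open import Data.Nat.Base as ℕ using (ℕ)
open import Data.Product.Base using (Σ-syntax; ∃; ∃-syntax; _×_)
open import Data.Rational.Base using (ℚ; _<_)
open import Data.Refinement using (Refinement-syntax; value)
open import Data.Sum.Base using (_⊎_)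
open import Function.Bundles using (_⇔_)
open import Function.Definitions using (Injective)
open import Level using (Level)
open import Relation.Binary.Definitions using (Decidable; Irreflexive; Symmetric)
open import Relation.Binary.PropositionalEquality.Core using (_≡_; _≢_; refl)
open import Relation.Nullary.Negation.Core using (¬_)

IsMinimum : ∀ {ℓ : Level} → (ℕ → Set ℓ) → ℕ → Set ℓ
IsMinimum P m = P m × (∀ k → P k → m ℕ.≤ k)

-- Real numbers as two-sided, located Dedekind cuts of ℚ.
record ℝ : Set₁ where
  field
    lower upper     : ℚ → Set
    lower-inhabited : ∃ lower
    upper-inhabited : ∃ upper
    lower-rounded   : ∀ q → lower q ⇔ (∃[ r ] q < r × lower r)
    upper-rounded   : ∀ r → upper r ⇔ (∃[ q ] q < r × upper q)
    disjoint        : ∀ q → ¬ (lower q × upper q)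
    located         : ∀ {q r} → q < r → lower q ⊎ upper r

infix 4 _≤ᴿ_
_≤ᴿ_ : ℝ → ℝ → Set
x ≤ᴿ y = ∀ q → ℝ.lower x q → ℝ.lower y q

record Graph (V : Set) : Set₁ where
  field
    Adj    : V → V → Set
    adj?   : Decidable Adj
    sym    : Symmetric Adj
    irrefl : Irreflexive _≡_ Adj

-- The vertex type is a refinement (its membership proofs are irrelevant), so
-- that vertices of the subgraph are equal exactly when they are equal in V.
induced : ∀ {V} → Graph V → (P : V → Set) → Graph [ v ∈ V ∣ P v ]
induced G P = record
  { Adj    = λ u v → Adj (value u) (value v)
  ; adj?   = λ u v → adj? (value u) (value v)
  ; sym    = sym
  ; irrefl = λ { refl → irrefl refl }
  }
  where open Graph G

record Cycle {V : Set} (G : Graph V) : Set where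
  open Graph G
  field
    excess    : ℕ

  -- The number of vertices is 3 + excess, i.e. an arbitrary number ≥ 3.
  field
    vertex    : Fin (3 ℕ.+ excess) → V
    injective : Injective _≡_ _≡_ vertex
    step      : ∀ (i : Fin (2 ℕ.+ excess)) → Adj (vertex (inject₁ i)) (vertex (suc i))
    close     : Adj (vertex (fromℕ (2 ℕ.+ excess))) (vertex zero)

IsForest : ∀ {V} → Graph V → Set
IsForest G = ¬ Cycle G

IsFeedbackVertexCover : ∀ {n} → Graph (Fin n) → Subset n → Set
IsFeedbackVertexCover G S = IsForest (induced G (_∉ S))

IsMFVC : ∀ {n} → Graph (Fin n) → ℕ → Set
IsMFVC {n} G = IsMinimum λ k → Σ[ S ∈ Subset n ] IsFeedbackVertexCover G S × ∣ S ∣ ≡ k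

record Interval : Set₁ where
  field
    left right : ℝ
    left≤right : left ≤ᴿ right

Box : ℕ → Set₁
Box b = Fin b → Interval

infix 4 _∈ᴮ_
_∈ᴮ_ : ∀ {b} → (Fin b → ℝ) → Box b → Set
p ∈ᴮ B = ∀ i → Interval.left (B i) ≤ᴿ p i × p i ≤ᴿ Interval.right (B i)

Intersect : ∀ {b} → Box b → Box b → Set₁
Intersect {b} A B = Σ[ p ∈ (Fin b → ℝ) ] p ∈ᴮ A × p ∈ᴮ B

IsIntersectionGraph : ∀ {V b} → Graph V → (V → Box b) → Set₁
IsIntersectionGraph G f = ∀ u v → u ≢ v → Graph.Adj G u v ⇔ Intersect (f u) (f v)

IsBoxicity : ∀ {V} → Graph V → ℕ → Set₁
IsBoxicity {V} G = IsMinimum λ b → Σ[ f ∈ (V → Box b) ] IsIntersectionGraph G f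

{-# OPTIONS --safe #-}
module Submission where

-- Let S be a feedback vertex cover. Root the trees of G − S and give every vertex its interval in
-- an Euler tour (vertices meet iff one is an ancestor of the other) and the interval [depth, depth + 1]:
-- together these two dimensions represent G − S. Give the vertices of S universal intervals there, and
-- add for each s ∈ S a dimension in which s is [0, 0], its neighbours are [0, 1] and all other vertices
-- are [1, 1]; it separates s from exactly its non-neighbours and no other pair. Hence box(G) ≤ ∣S∣ + 2.
-- A nonempty forest has a leaf, so the
-- tour can be built by inserting leaves one at a time.

open import Data.Empty using (⊥; ⊥-elim)
open import Data.Fin.Base using (Fin; zero; suc; toℕ)
open import Data.Fin.Properties using (_≟_; any?; injective⇒≤; toℕ<n; toℕ-injective; toℕ-inject₁; toℕ-fromℕ)
open import Data.Fin.Subset using (Subset; inside; outside; _∈_; _∉_; _-_; ∁; ⁅_⁆; ∣_∣)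
open import Data.Fin.Subset.Properties using (_∈?_; nonempty?; p─q⊆p; x∈p∧x≢y⇒x∈p-y; x∈p⇒∣p-x∣<∣p∣; x∈∁p⇒x∉p; x∉p⇒x∈∁p)
import Data.Integer.Base as ℤ
import Data.Integer.Properties as ℤ
open import Data.Irrelevant using ([_])
open import Data.List.Base using (List; []; _∷_; map; length; lookup)
open import Data.List.Membership.Propositional using () renaming (_∈_ to _∈ᴸ_)
open import Data.List.Membership.Propositional.Properties using (∈-map⁺; ∈-lookup)
open import Data.List.Properties using (length-map)
open import Data.List.Relation.Unary.All as All using (All; []; _∷_)
open import Data.List.Relation.Unary.All.Properties as All using ()
open import Data.List.Relation.Unary.Any using (here; there)
open import Data.Nat.Base using (ℕ; zero; suc; _+_; _≤_; _<_; _⊔_; z≤n; s≤s; s≤s⁻¹)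
open import Data.Nat.Coprimality using (1-coprimeTo) renaming (sym to coprime-sym)
open import Data.Nat.Properties using (≤-refl; ≤-reflexive; ≤-trans; <⇒≤; <-irrefl; <⇒≱; ≰⇒>; ≤-antisym; ≤-total; ≮⇒≥; n≤1+n; n<1+n; m≤m⊔n; m≤n⊔m; m≤n⇒m<n∨m≡n; <-≤-trans; +-suc; +-comm; ⊔-lub; anyUpTo?; m≤n⇒m≤1+n)
open import Data.Product.Base using (Σ-syntax; ∃-syntax; _×_; _,_; proj₁; proj₂; swap)
open import Data.Rational.Base as ℚ using (ℚ; mkℚ)
import Data.Rational.Properties as ℚ
open import Data.Refinement using (value; _,_)
open import Data.Sum.Base as Sum using (_⊎_; inj₁; inj₂)
open import Data.Vec.Base using ([]; _∷_; here; there)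
open import Defs
open import Function.Base using (_∘_)
open import Function.Bundles using (_⇔_; mk⇔; Equivalence)
open import Relation.Binary.PropositionalEquality using (_≡_; _≢_; refl; sym; trans; cong; subst; subst₂)
open import Relation.Nullary.Decidable using (Dec; yes; no; _×-dec_; ¬?)
open import Relation.Nullary.Negation using (¬_; contradiction)

-- Intervals with natural endpoints

record ℕ-Interval : Set where
  constructor _‥_∣_
  field
    lo hi : ℕ
    lo≤hi : lo ≤ hi

open ℕ-Interval

Meets : ℕ-Interval → ℕ-Interval → Set
Meets I J = lo I ≤ hi J × lo J ≤ hi I

ℚ⇒ℝ : ℚ → ℝ
ℚ⇒ℝ a = record
  { lower           = ℚ._< a
  ; upper           = a ℚ.<_
  ; lower-inhabited = a ℚ.- ℚ.1ℚ , subst (a ℚ.- ℚ.1ℚ ℚ.<_) (ℚ.+-identityʳ a) (ℚ.+-monoʳ-< a (ℚ.negative⁻¹ (ℚ.- ℚ.1ℚ)))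
  ; upper-inhabited = a ℚ.+ ℚ.1ℚ , subst (ℚ._< a ℚ.+ ℚ.1ℚ) (ℚ.+-identityʳ a) (ℚ.+-monoʳ-< a (ℚ.positive⁻¹ ℚ.1ℚ))
  ; lower-rounded   = λ q → mk⇔ ℚ.<-dense (λ (r , q<r , r<a) → ℚ.<-trans q<r r<a)
  ; upper-rounded   = λ r → mk⇔ (λ a<r → let q , a<q , q<r = ℚ.<-dense a<r in q , q<r , a<q)
                                (λ (q , q<r , a<q) → ℚ.<-trans a<q q<r)
  ; disjoint        = λ q (q<a , a<q) → ℚ.<-asym q<a a<q
  ; located         = located
  }
  where
  located : ∀ {q r} → q ℚ.< r → q ℚ.< a ⊎ a ℚ.< r
  located {q} q<r with q ℚ.<? a
  ... | yes q<a = inj₁ q<a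
  ... | no  q≮a = inj₂ (ℚ.≤-<-trans (ℚ.≮⇒≥ q≮a) q<r)

ℚ⇒ℝ-mono-≤ : ∀ {a b} → a ℚ.≤ b → ℚ⇒ℝ a ≤ᴿ ℚ⇒ℝ b
ℚ⇒ℝ-mono-≤ a≤b q q<a = ℚ.<-≤-trans q<a a≤b

-- If `b < a`, then `b` lies in the lower cut of `a`, hence in its own lower cut, which is absurd.
ℚ⇒ℝ-cancel-≤ : ∀ {a b} → ℚ⇒ℝ a ≤ᴿ ℚ⇒ℝ b → a ℚ.≤ b
ℚ⇒ℝ-cancel-≤ {b = b} a≤b = ℚ.≮⇒≥ λ b<a → ℚ.<-irrefl refl (a≤b b b<a)

-- Built by `mkℚ` with denominator 1, so that comparing two images unfolds to comparing integers
-- multiplied by 1.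
ℕ⇒ℚ : ℕ → ℚ
ℕ⇒ℚ k = mkℚ (ℤ.+ k) 0 (coprime-sym (1-coprimeTo k))

ℕ⇒ℝ : ℕ → ℝ
ℕ⇒ℝ = ℚ⇒ℝ ∘ ℕ⇒ℚ

ℕ⇒ℝ-mono-≤ : ∀ {j k} → j ≤ k → ℕ⇒ℝ j ≤ᴿ ℕ⇒ℝ k
ℕ⇒ℝ-mono-≤ {j} {k} j≤k = ℚ⇒ℝ-mono-≤ (ℚ.*≤*
  (subst₂ ℤ._≤_ (sym (ℤ.*-identityʳ (ℤ.+ j))) (sym (ℤ.*-identityʳ (ℤ.+ k))) (ℤ.+≤+ j≤k)))

ℕ⇒ℝ-cancel-≤ : ∀ {j k} → ℕ⇒ℝ j ≤ᴿ ℕ⇒ℝ k → j ≤ k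
ℕ⇒ℝ-cancel-≤ {j} {k} j≤k with ℚ⇒ℝ-cancel-≤ {ℕ⇒ℚ j} {ℕ⇒ℚ k} j≤k
... | ℚ.*≤* p = ℤ.drop‿+≤+ (subst₂ ℤ._≤_ (ℤ.*-identityʳ (ℤ.+ j)) (ℤ.*-identityʳ (ℤ.+ k)) p)

⟦_⟧ : ℕ-Interval → Interval
⟦ I ⟧ = record { left = ℕ⇒ℝ (lo I) ; right = ℕ⇒ℝ (hi I) ; left≤right = ℕ⇒ℝ-mono-≤ (lo≤hi I) }

boxes : ∀ {V : Set} (dims : List (V → ℕ-Interval)) → V → Box (length dims)
boxes dims v i = ⟦ lookup dims i v ⟧

boxes-intersect⇒meet : ∀ {V : Set} (dims : List (V → ℕ-Interval)) {u v} →
  Intersect (boxes dims u) (boxes dims v) → All (λ D → Meets (D u) (D v)) dims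
boxes-intersect⇒meet []         _                 = []
boxes-intersect⇒meet (D ∷ dims) {u} {v} (p , p∈u , p∈v) =
  ( ℕ⇒ℝ-cancel-≤ {lo (D u)} {hi (D v)} (λ q → proj₂ (p∈v zero) q ∘ proj₁ (p∈u zero) q)
  , ℕ⇒ℝ-cancel-≤ {lo (D v)} {hi (D u)} (λ q → proj₂ (p∈u zero) q ∘ proj₁ (p∈v zero) q)
  ) ∷ boxes-intersect⇒meet dims (p ∘ suc , p∈u ∘ suc , p∈v ∘ suc)

meet⇒boxes-intersect : ∀ {V : Set} (dims : List (V → ℕ-Interval)) {u v} →
  All (λ D → Meets (D u) (D v)) dims → Intersect (boxes dims u) (boxes dims v)
meet⇒boxes-intersect dims {u} {v} meets =
  -- In each coordinate the larger of the two left endpoints is a common point.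
  (λ i → ℕ⇒ℝ (lo (I i) ⊔ lo (J i))) ,
  (λ i → ℕ⇒ℝ-mono-≤ (m≤m⊔n (lo (I i)) (lo (J i))) , ℕ⇒ℝ-mono-≤ (⊔-lub (lo≤hi (I i)) (proj₂ (meet i)))) ,
  (λ i → ℕ⇒ℝ-mono-≤ (m≤n⊔m (lo (I i)) (lo (J i))) , ℕ⇒ℝ-mono-≤ (⊔-lub (proj₁ (meet i)) (lo≤hi (J i))))
  where
  I J : Fin (length dims) → ℕ-Interval
  I i = lookup dims i u
  J i = lookup dims i v
  meet : ∀ i → Meets (I i) (J i)
  meet i = All.lookup meets (∈-lookup i)

boxes-represent : ∀ {V : Set} (G : Graph V) (dims : List (V → ℕ-Interval)) →
  (∀ u v → u ≢ v → Graph.Adj G u v ⇔ All (λ D → Meets (D u) (D v)) dims) →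
  IsIntersectionGraph G (boxes dims)
boxes-represent G dims rep u v u≢v = mk⇔
  (meet⇒boxes-intersect dims ∘ Equivalence.to (rep u v u≢v))
  (Equivalence.from (rep u v u≢v) ∘ boxes-intersect⇒meet dims)

-- Opening a gap in ℕ

-- The increasing map ℕ → ℕ whose range omits exactly t and 1 + t.
gap : ℕ → ℕ → ℕ
gap zero    x       = 2 + x
gap (suc t) zero    = zero
gap (suc t) (suc x) = suc (gap t x)

gap-mono-≤ : ∀ t {x y} → x ≤ y → gap t x ≤ gap t y
gap-mono-≤ zero    x≤y       = s≤s (s≤s x≤y)
gap-mono-≤ (suc t) z≤n       = z≤n
gap-mono-≤ (suc t) (s≤s x≤y) = s≤s (gap-mono-≤ t x≤y)

gap-mono-< : ∀ t {x y} → x < y → gap t x < gap t y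
gap-mono-< zero    x<y                           = s≤s (s≤s x<y)
gap-mono-< (suc t) {zero}  {suc y} _             = s≤s z≤n
gap-mono-< (suc t) {suc x} {suc y} (s≤s x<y)     = s≤s (gap-mono-< t x<y)

gap-cancel-≤ : ∀ t {x y} → gap t x ≤ gap t y → x ≤ y
gap-cancel-≤ t g≤ = ≮⇒≥ λ y<x → <⇒≱ (gap-mono-< t y<x) g≤

gap-cancel-< : ∀ t {x y} → gap t x < gap t y → x < y
gap-cancel-< t g< = ≰⇒> λ y≤x → <⇒≱ g< (gap-mono-≤ t y≤x)

gap-below : ∀ {t x} → x < t → gap t x < t
gap-below {suc t} {zero}  _         = s≤s z≤n
gap-below {suc t} {suc x} (s≤s x<t) = s≤s (gap-below x<t)

gap-above : ∀ {t x} → t ≤ x → suc t < gap t x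
gap-above {zero}          _         = s≤s (s≤s z≤n)
gap-above {suc t} {suc x} (s≤s t≤x) = s≤s (gap-above t≤x)

gap-below⁻¹ : ∀ {t x} → gap t x ≤ suc t → x < t
gap-below⁻¹ g≤ = ≰⇒> λ t≤x → <⇒≱ (gap-above t≤x) g≤

gap-above⁻¹ : ∀ {t x} → t ≤ gap t x → t ≤ x
gap-above⁻¹ t≤g = ≮⇒≥ λ x<t → <⇒≱ (gap-below x<t) t≤g

-- Used with `x` an old left endpoint: none falls into the new interval from `t` to `suc t`, so an
-- inserted vertex has no descendants.
gap-avoids : ∀ {t x} → t ≤ gap t x → gap t x ≤ suc t → ⊥
gap-avoids t≤g g≤ = <⇒≱ (gap-below⁻¹ g≤) (gap-above⁻¹ t≤g)

-- Acyclic vertex sets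

module _ {n : ℕ} (G : Graph (Fin n)) where
  open Graph G renaming (sym to adj-sym)

  -- Speaks of cycles of `G` itself rather than of an induced subgraph, so that it passes to smaller
  -- sets by mere inclusion.
  Acyclic : Subset n → Set
  Acyclic W = (C : Cycle G) → ¬ (∀ i → Cycle.vertex C i ∈ W)

  forest⇒acyclic : ∀ S → IsFeedbackVertexCover G S → Acyclic (∁ S)
  forest⇒acyclic S forest C C⊆∁S = forest record
    { excess    = excess
    ; vertex    = λ i → vertex i , [ x∈∁p⇒x∉p (C⊆∁S i) ]
    ; injective = injective ∘ cong value
    ; step      = step
    ; close     = close
    }
    where open Cycle C

  -- Existence of leaves

  -- At most one neighbour in `W`; an isolated vertex counts as a leaf.
  IsLeaf : Subset n → Fin n → Set
  IsLeaf W v = ∀ {u w} → u ∈ W → w ∈ W → Adj v u → Adj v w → u ≡ w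

  -- Only the values at 0 , … , k matter.
  record Path (W : Subset n) (k : ℕ) : Set where
    field
      at        : ℕ → Fin n
      within    : ∀ {i} → i ≤ k → at i ∈ W
      step      : ∀ {i} → i < k → Adj (at i) (at (suc i))
      injective : ∀ {i j} → i ≤ k → j ≤ k → at i ≡ at j → i ≡ j

    length< : k < n
    length< = injective⇒≤ {f = at ∘ toℕ {suc k}} λ {i} {j} eq →
      toℕ-injective (injective (s≤s⁻¹ (toℕ<n i)) (s≤s⁻¹ (toℕ<n j)) eq)

  -- The chord closes the initial segment of the path; the offset 2 ensures at least three vertices.
  path⇒cycle : ∀ {W k} (P : Path W k) j → 2 + j ≤ k → Adj (Path.at P 0) (Path.at P (2 + j)) →
    Σ[ C ∈ Cycle G ] (∀ i → Cycle.vertex C i ∈ W)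
  path⇒cycle P j 2+j≤k a = record
    { excess    = j
    ; vertex    = at ∘ toℕ
    ; injective = λ {x} {y} eq → toℕ-injective (injective (bound x) (bound y) eq)
    ; step      = λ i → subst (λ x → Adj (at x) (at (suc (toℕ i)))) (sym (toℕ-inject₁ i))
                          (step (<-≤-trans (toℕ<n i) 2+j≤k))
    ; close     = subst (λ x → Adj (at x) (at 0)) (sym (toℕ-fromℕ (2 + j))) (adj-sym a)
    } , λ i → within (bound i)
    where
    open Path P
    bound : (i : Fin (3 + j)) → toℕ i ≤ _
    bound i = ≤-trans (s≤s⁻¹ (toℕ<n i)) 2+j≤k

  -- The path grows at the front, so its active end is always `at 0` and the vertex visited just
  -- before is `at 1`.
  extend : ∀ {W k} (P : Path W k) u → u ∈ W → Adj u (Path.at P 0) →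
    (∀ {i} → i ≤ k → u ≢ Path.at P i) → Path W (suc k)
  extend {W} {k} P u u∈W a fresh = record
    { at = at′ ; within = within′ ; step = step′ ; injective = injective′ }
    where
    open Path P
    at′ : ℕ → Fin n
    at′ zero    = u
    at′ (suc i) = at i
    within′ : ∀ {i} → i ≤ suc k → at′ i ∈ W
    within′ {zero}  _         = u∈W
    within′ {suc i} (s≤s i≤k) = within i≤k
    step′ : ∀ {i} → i < suc k → Adj (at′ i) (at′ (suc i))
    step′ {zero}  _         = a
    step′ {suc i} (s≤s i<k) = step i<k
    injective′ : ∀ {i j} → i ≤ suc k → j ≤ suc k → at′ i ≡ at′ j → i ≡ j
    injective′ {zero}  {zero}  _         _         _  = refl
    injective′ {zero}  {suc j} _         (s≤s j≤k) eq = contradiction eq (fresh j≤k)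
    injective′ {suc i} {zero}  (s≤s i≤k) _         eq = contradiction (sym eq) (fresh i≤k)
    injective′ {suc i} {suc j} (s≤s i≤k) (s≤s j≤k) eq = cong suc (injective i≤k j≤k eq)

  -- Walk on, never turning back, until no other neighbour is left; returning to the path would close a cycle.
  path⇒leaf : ∀ {W k} fuel → n ≤ k + fuel → Acyclic W → Path W k → ∃[ v ] v ∈ W × IsLeaf W v
  path⇒leaf {W} {k} zero n≤k+0 acyclic P =
    contradiction (≤-trans n≤k+0 (≤-reflexive (+-comm k 0))) (<⇒≱ (Path.length< P))
  path⇒leaf {W} {k} (suc fuel) n≤k+f acyclic P
    with any? (λ u → (u ∈? W) ×-dec adj? (Path.at P 0) u ×-dec ¬? (u ≟ Path.at P 1))
  ... | no none = Path.at P 0 , Path.within P z≤n , λ u∈W w∈W a b → trans (only u∈W a) (sym (only w∈W b))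
    where
    only : ∀ {u} → u ∈ W → Adj (Path.at P 0) u → u ≡ Path.at P 1
    only {u} u∈W a with u ≟ Path.at P 1
    ... | yes eq = eq
    ... | no neq = contradiction (u , u∈W , a , neq) none
  ... | yes (u , u∈W , a , u≢) with anyUpTo? (λ i → u ≟ Path.at P i) (suc k)
  ...   | no fresh = path⇒leaf fuel (≤-trans n≤k+f (≤-reflexive (+-suc k fuel))) acyclic
                       (extend P u u∈W (adj-sym a) λ i≤k eq → fresh (_ , s≤s i≤k , eq))
  ...   | yes (0           , _         , eq) = contradiction a (irrefl (sym eq))
  ...   | yes (1           , _         , eq) = contradiction eq u≢
  ...   | yes (suc (suc j) , s≤s 2+j≤k , eq) =
            let C , C⊆W = path⇒cycle P j 2+j≤k (subst (Adj (Path.at P 0)) eq a) in ⊥-elim (acyclic C C⊆W)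

  acyclic⇒leaf : ∀ {W v} → Acyclic W → v ∈ W → ∃[ v ] v ∈ W × IsLeaf W v
  acyclic⇒leaf {W} {v} acyclic v∈W = path⇒leaf n ≤-refl acyclic (record
    -- On this one-vertex path `at 1` is a dummy equal to `v`, which is never its own neighbour, so
    -- the first step of the walk is unrestricted.
    { at = λ _ → v ; within = λ _ → v∈W ; step = λ () ; injective = λ { z≤n z≤n _ → refl } })

  -- Layouts of forests

  -- l and r are the positions in the Euler tour, d is the depth.
  record Layout (W : Subset n) : Set where
    field
      l r d       : Fin n → ℕ
      l<r         : ∀ {v} → v ∈ W → l v < r v
      l-injective : ∀ {u v} → u ∈ W → v ∈ W → l u ≡ l v → u ≡ v
      -- That `v` is a proper descendant of `u` is expressed by `l u < l v` and `l v ≤ r u`.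
      nested      : ∀ {u v} → u ∈ W → v ∈ W → l u < l v → l v ≤ r u → d u < d v
      adj⇒meet    : ∀ {u v} → u ∈ W → v ∈ W → Adj u v → l u ≤ r v × d u ≤ suc (d v)
      meet⇒adj    : ∀ {u v} → u ∈ W → v ∈ W → u ≢ v →
                    l u ≤ l v → l v ≤ r u → d v ≤ suc (d u) → Adj u v

  -- Inserting a vertex into a layout

  module _ {W v} (L : Layout (W - v)) where
    open Layout L

    -- The tour is cut open at `t`, and `v` receives the two freed positions and depth `δ`. The
    -- ancestors of `v` are then the `u` with `l u < t` and `t ≤ r u`. The hypotheses say that these
    -- are shallower than `δ`, and that the neighbours of `v` are exactly those among them with
    -- `δ ≤ suc (d u)`.
    insert : ∀ t δ →
      (∀ {u} → u ∈ W - v → l u < t → t ≤ r u → d u < δ) →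
      (∀ {u} → u ∈ W - v → Adj v u → l u < t × t ≤ r u × δ ≤ suc (d u)) →
      (∀ {u} → u ∈ W - v → l u < t → t ≤ r u → δ ≤ suc (d u) → Adj u v) →
      Layout W
    insert t δ deeper adj⇒ ⇒adj = record
      { l = l′ ; r = r′ ; d = d′ ; l<r = l<r′ ; l-injective = l-injective′
      ; nested = nested′ ; adj⇒meet = adj⇒meet′ ; meet⇒adj = meet⇒adj′ }
      where
      choose : ℕ → (Fin n → ℕ) → Fin n → ℕ
      choose x f u with u ≟ v
      ... | yes _ = x
      ... | no  _ = f u

      l′ r′ d′ : Fin n → ℕ
      l′ = choose t (gap t ∘ l)
      r′ = choose (suc t) (gap t ∘ r)
      d′ = choose δ d

      l<r′ : ∀ {u} → u ∈ W → l′ u < r′ u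
      l<r′ {u} u∈W with u ≟ v
      ... | yes _  = n<1+n t
      ... | no u≢v = gap-mono-< t (l<r (x∈p∧x≢y⇒x∈p-y u∈W u≢v))

      l-injective′ : ∀ {u w} → u ∈ W → w ∈ W → l′ u ≡ l′ w → u ≡ w
      l-injective′ {u} {w} u∈W w∈W eq with u ≟ v | w ≟ v
      ... | yes u≡v | yes w≡v = trans u≡v (sym w≡v)
      ... | yes _   | no _    = ⊥-elim (gap-avoids (≤-reflexive eq) (m≤n⇒m≤1+n (≤-reflexive (sym eq))))
      ... | no _    | yes _   = ⊥-elim (gap-avoids (≤-reflexive (sym eq)) (m≤n⇒m≤1+n (≤-reflexive eq)))
      ... | no u≢v  | no w≢v  = l-injective (x∈p∧x≢y⇒x∈p-y u∈W u≢v) (x∈p∧x≢y⇒x∈p-y w∈W w≢v)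
        (≤-antisym (gap-cancel-≤ t (≤-reflexive eq)) (gap-cancel-≤ t (≤-reflexive (sym eq))))

      nested′ : ∀ {u w} → u ∈ W → w ∈ W → l′ u < l′ w → l′ w ≤ r′ u → d′ u < d′ w
      nested′ {u} {w} u∈W w∈W lu<lw lw≤ru with u ≟ v | w ≟ v
      ... | yes _   | yes _   = contradiction lu<lw (<-irrefl refl)
      ... | yes _   | no _    = ⊥-elim (gap-avoids (<⇒≤ lu<lw) lw≤ru)
      ... | no u≢v  | yes _   = deeper (x∈p∧x≢y⇒x∈p-y u∈W u≢v)
        (gap-below⁻¹ (m≤n⇒m≤1+n (<⇒≤ lu<lw))) (gap-above⁻¹ lw≤ru)
      ... | no u≢v  | no w≢v  = nested (x∈p∧x≢y⇒x∈p-y u∈W u≢v) (x∈p∧x≢y⇒x∈p-y w∈W w≢v)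
        (gap-cancel-< t lu<lw) (gap-cancel-≤ t lw≤ru)

      adj⇒meet′ : ∀ {u w} → u ∈ W → w ∈ W → Adj u w → l′ u ≤ r′ w × d′ u ≤ suc (d′ w)
      adj⇒meet′ {u} {w} u∈W w∈W a with u ≟ v | w ≟ v
      ... | yes refl | yes refl = contradiction a (irrefl refl)
      ... | yes refl | no w≢v   =
        let _ , t≤rw , δ≤ = adj⇒ (x∈p∧x≢y⇒x∈p-y w∈W w≢v) a
        in ≤-trans (n≤1+n t) (<⇒≤ (gap-above t≤rw)) , δ≤
      ... | no u≢v   | yes refl =
        let u∈          = x∈p∧x≢y⇒x∈p-y u∈W u≢v
            lu<t , t≤ru , _ = adj⇒ u∈ (adj-sym a)
        in m≤n⇒m≤1+n (<⇒≤ (gap-below lu<t)) , m≤n⇒m≤1+n (<⇒≤ (deeper u∈ lu<t t≤ru))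
      ... | no u≢v   | no w≢v   =
        let lu≤rw , du≤ = adj⇒meet (x∈p∧x≢y⇒x∈p-y u∈W u≢v) (x∈p∧x≢y⇒x∈p-y w∈W w≢v) a
        in gap-mono-≤ t lu≤rw , du≤

      meet⇒adj′ : ∀ {u w} → u ∈ W → w ∈ W → u ≢ w →
        l′ u ≤ l′ w → l′ w ≤ r′ u → d′ w ≤ suc (d′ u) → Adj u w
      meet⇒adj′ {u} {w} u∈W w∈W u≢w lu≤lw lw≤ru dw≤ with u ≟ v | w ≟ v
      ... | yes u≡v | yes w≡v  = contradiction (trans u≡v (sym w≡v)) u≢w
      ... | yes _   | no _     = ⊥-elim (gap-avoids lu≤lw lw≤ru)
      ... | no u≢v  | yes refl = ⇒adj (x∈p∧x≢y⇒x∈p-y u∈W u≢v)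
        (gap-below⁻¹ (m≤n⇒m≤1+n lu≤lw)) (gap-above⁻¹ lw≤ru) dw≤
      ... | no u≢v  | no w≢v   = meet⇒adj (x∈p∧x≢y⇒x∈p-y u∈W u≢v) (x∈p∧x≢y⇒x∈p-y w∈W w≢v) u≢w
        (gap-cancel-≤ t lu≤lw) (gap-cancel-≤ t lw≤ru) dw≤

  -- No left endpoint is below 0, so at position 0 the vertex has no ancestors and becomes the root
  -- of a new tree.
  insert-isolated : ∀ {W v} → (∀ {u} → u ∈ W - v → ¬ Adj v u) → Layout (W - v) → Layout W
  insert-isolated isolated L = insert L 0 0
    (λ _ ()) (λ u∈ a → contradiction a (isolated u∈)) (λ _ ())

  -- A leaf is placed directly after the left endpoint of its neighbour p.
  insert-leaf : ∀ {W v p} → IsLeaf W v → p ∈ W - v → Adj v p → Layout (W - v) → Layout W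
  insert-leaf {W} {v} {p} leaf p∈ a L = insert L (suc (l p)) (suc (d p))
    (λ u∈ lu<t t≤ru → s≤s (shallower u∈ (s≤s⁻¹ lu<t) t≤ru))
    (λ u∈ b → neighbour (leaf (⊆W p∈) (⊆W u∈) a b))
    (λ u∈ lu<t t≤ru δ≤ → is-p u∈ (s≤s⁻¹ lu<t) t≤ru (s≤s⁻¹ δ≤))
    where
    open Layout L
    ⊆W : ∀ {u} → u ∈ W - v → u ∈ W
    ⊆W = p─q⊆p W ⁅ v ⁆
    -- No left endpoint lies between that of `p` and the new position, so an interval around that
    -- position belongs to `p` or to an ancestor of `p`.
    shallower : ∀ {u} → u ∈ W - v → l u ≤ l p → l p < r u → d u ≤ d p
    shallower u∈ lu≤lp lp<ru with m≤n⇒m<n∨m≡n lu≤lp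
    ... | inj₁ lu<lp = <⇒≤ (nested u∈ p∈ lu<lp (<⇒≤ lp<ru))
    ... | inj₂ lu≡lp = ≤-reflexive (cong d (l-injective u∈ p∈ lu≡lp))
    neighbour : ∀ {u} → p ≡ u → l u < suc (l p) × l p < r u × suc (d p) ≤ suc (d u)
    neighbour refl = ≤-refl , l<r p∈ , ≤-refl
    -- Proper ancestors of `p` have depth below `d p`, so the depth condition leaves only `p`.
    is-p : ∀ {u} → u ∈ W - v → l u ≤ l p → l p < r u → d p ≤ d u → Adj u v
    is-p u∈ lu≤lp lp<ru dp≤du with m≤n⇒m<n∨m≡n lu≤lp
    ... | inj₁ lu<lp = contradiction dp≤du (<⇒≱ (nested u∈ p∈ lu<lp (<⇒≤ lp<ru)))
    ... | inj₂ lu≡lp = subst (λ u → Adj u v) (sym (l-injective u∈ p∈ lu≡lp)) (adj-sym a)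

  acyclic⇒layout : ∀ k {W} → ∣ W ∣ ≤ k → Acyclic W → Layout W
  acyclic⇒layout k {W} ∣W∣≤k acyclic with nonempty? W
  ... | no empty = record
    { l = λ _ → 0 ; r = λ _ → 0 ; d = λ _ → 0
    ; l<r         = λ u∈ → ⊥-elim (empty (_ , u∈))
    ; l-injective = λ u∈ → ⊥-elim (empty (_ , u∈))
    ; nested      = λ u∈ → ⊥-elim (empty (_ , u∈))
    ; adj⇒meet    = λ u∈ → ⊥-elim (empty (_ , u∈))
    ; meet⇒adj    = λ u∈ → ⊥-elim (empty (_ , u∈))
    }
  acyclic⇒layout zero    ∣W∣≤0 acyclic | yes (_ , w∈W) =
    contradiction (<-≤-trans (x∈p⇒∣p-x∣<∣p∣ w∈W) ∣W∣≤0) λ ()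
  acyclic⇒layout (suc k) {W} ∣W∣≤k acyclic | yes (_ , w∈W)
    with v , v∈W , leaf ← acyclic⇒leaf acyclic w∈W
    with L ← acyclic⇒layout k (s≤s⁻¹ (<-≤-trans (x∈p⇒∣p-x∣<∣p∣ v∈W) ∣W∣≤k))
               (λ C C⊆ → acyclic C (p─q⊆p W ⁅ v ⁆ ∘ C⊆))
    with any? (λ u → (u ∈? (W - v)) ×-dec adj? v u)
  ... | yes (p , p∈ , a) = insert-leaf leaf p∈ a L
  ... | no none          = insert-isolated (λ u∈ a → none (_ , u∈ , a)) L

  -- Dimensions for the forest and for the feedback vertex cover

  star : Fin n → Fin n → ℕ-Interval
  star x u with u ≟ x
  ... | yes _ = 0 ‥ 0 ∣ z≤n
  ... | no  _ with adj? x u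
  ...   | yes _ = 0 ‥ 1 ∣ z≤n
  ...   | no  _ = 1 ‥ 1 ∣ ≤-refl

  -- The intervals of `x` and its neighbours share 0, and those of all vertices other than `x` share
  -- 1.
  adj⇒star-meets : ∀ x {u v} → u ≢ v → Adj u v → Meets (star x u) (star x v)
  adj⇒star-meets x {u} {v} u≢v a with u ≟ x | v ≟ x
  ... | yes u≡x | yes v≡x = contradiction (trans u≡x (sym v≡x)) u≢v
  adj⇒star-meets x {u} {v} u≢v a | yes refl | no _ with adj? u v
  ... | yes _ = z≤n , z≤n
  ... | no ¬a = contradiction a ¬a
  adj⇒star-meets x {u} {v} u≢v a | no _ | yes refl with adj? v u
  ... | yes _ = z≤n , z≤n
  ... | no ¬a = contradiction (adj-sym a) ¬a
  adj⇒star-meets x {u} {v} u≢v a | no _ | no _ with adj? x u | adj? x v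
  ... | yes _ | yes _ = z≤n , z≤n
  ... | yes _ | no _  = z≤n , ≤-refl
  ... | no _  | yes _ = ≤-refl , z≤n
  ... | no _  | no _  = ≤-refl , ≤-refl

  star-meets⇒adj : ∀ x {v} → x ≢ v → Meets (star x x) (star x v) → Adj x v
  star-meets⇒adj x {v} x≢v m with x ≟ x | v ≟ x
  ... | no x≢x | _       = contradiction refl x≢x
  ... | yes _  | yes v≡x = contradiction (sym v≡x) x≢v
  ... | yes _  | no _ with adj? x v
  ...   | yes a = a
  -- For a non-neighbour, `proj₂ m` would prove `1 ≤ 0`.
  ...   | no _ with () ← proj₂ m

-- Making the cover universal in a dimension

bounded : ∀ {n} (f : Fin n → ℕ) → ∃[ M ] (∀ i → f i ≤ M)
bounded {zero}  f = 0 , λ ()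
bounded {suc n} f =
  let M , f≤M = bounded (f ∘ suc) in
  f zero ⊔ M , λ { zero → m≤m⊔n (f zero) M ; (suc i) → ≤-trans (f≤M i) (m≤n⊔m (f zero) M) }

module _ {n : ℕ} (S : Subset n) (f : Fin n → ℕ-Interval) where

  -- On `S` the interval runs from 0 to a bound on all left endpoints of `f`; being finite, it still
  -- meets every `f u`.
  universal-on : Fin n → ℕ-Interval
  universal-on u with u ∈? S
  ... | yes _ = 0 ‥ proj₁ (bounded (lo ∘ f)) ∣ z≤n
  ... | no  _ = f u

  universal-on-meets : ∀ {u v} → (u ∉ S → v ∉ S → Meets (f u) (f v)) → Meets (universal-on u) (universal-on v)
  universal-on-meets {u} {v} meets with u ∈? S | v ∈? S
  ... | yes _  | yes _  = z≤n , z≤n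
  ... | yes _  | no _   = z≤n , proj₂ (bounded (lo ∘ f)) v
  ... | no _   | yes _  = proj₂ (bounded (lo ∘ f)) u , z≤n
  ... | no u∉S | no v∉S = meets u∉S v∉S

  universal-on-meets⁻¹ : ∀ {u v} → u ∉ S → v ∉ S → Meets (universal-on u) (universal-on v) → Meets (f u) (f v)
  universal-on-meets⁻¹ {u} {v} u∉S v∉S m with u ∈? S | v ∈? S
  ... | yes u∈S | _       = contradiction u∈S u∉S
  ... | no _    | yes v∈S = contradiction v∈S v∉S
  ... | no _    | no _    = m

-- Listing the elements of a subset

elements : ∀ {n} → Subset n → List (Fin n)
elements []            = []
elements (inside  ∷ S) = zero ∷ map suc (elements S)
elements (outside ∷ S) = map suc (elements S)

length-elements : ∀ {n} (S : Subset n) → length (elements S) ≡ ∣ S ∣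
length-elements []            = refl
length-elements (inside  ∷ S) = cong suc (trans (length-map suc (elements S)) (length-elements S))
length-elements (outside ∷ S) = trans (length-map suc (elements S)) (length-elements S)

∈-elements : ∀ {n x} {S : Subset n} → x ∈ S → x ∈ᴸ elements S
∈-elements {S = inside  ∷ S} here        = here refl
∈-elements {S = inside  ∷ S} (there x∈S) = there (∈-map⁺ suc (∈-elements x∈S))
∈-elements {S = outside ∷ S} (there x∈S) = ∈-map⁺ suc (∈-elements x∈S)

-- The complete box representation

module _ {n : ℕ} (G : Graph (Fin n)) (S : Subset n) (L : Layout G (∁ S)) where
  open Graph G renaming (sym to adj-sym)
  open Layout L

  tour depth : Fin n → ℕ-Interval
  tour v with v ∈? S
  -- A placeholder that `universal-on` overwrites; the layout gives `l v < r v` only outside `S`.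
  ... | yes _ = 0 ‥ 0 ∣ z≤n
  ... | no v∉S = l v ‥ r v ∣ <⇒≤ (l<r (x∉p⇒x∈∁p v∉S))
  depth v = d v ‥ suc (d v) ∣ n≤1+n (d v)

  dimensions : List (Fin n → ℕ-Interval)
  dimensions = universal-on S tour ∷ universal-on S depth ∷ map (star G) (elements S)

  length-dimensions : length dimensions ≡ 2 + ∣ S ∣
  length-dimensions = cong (2 +_) (trans (length-map (star G) (elements S)) (length-elements S))

  tour-meets : ∀ {u v} → u ∉ S → v ∉ S → Meets (tour u) (tour v) ⇔ (l u ≤ r v × l v ≤ r u)
  tour-meets {u} {v} u∉S v∉S with u ∈? S | v ∈? S
  ... | yes u∈S | _       = contradiction u∈S u∉S
  ... | no _    | yes v∈S = contradiction v∈S v∉S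
  ... | no _    | no _    = mk⇔ (λ m → m) (λ m → m)

  adj⇒dimensions-meet : ∀ {u v} → u ≢ v → Adj u v → All (λ D → Meets (D u) (D v)) dimensions
  adj⇒dimensions-meet {u} {v} u≢v a =
    universal-on-meets S tour (λ u∉S v∉S → Equivalence.from (tour-meets u∉S v∉S)
      (proj₁ (to u∉S v∉S) , proj₁ (from u∉S v∉S))) ∷
    universal-on-meets S depth (λ u∉S v∉S → proj₂ (to u∉S v∉S) , proj₂ (from u∉S v∉S)) ∷
    All.map⁺ (All.universal (λ x → adj⇒star-meets G x u≢v a) (elements S))
    where
    to : u ∉ S → v ∉ S → l u ≤ r v × d u ≤ suc (d v)
    to u∉S v∉S = adj⇒meet (x∉p⇒x∈∁p u∉S) (x∉p⇒x∈∁p v∉S) a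
    from : u ∉ S → v ∉ S → l v ≤ r u × d v ≤ suc (d u)
    from u∉S v∉S = adj⇒meet (x∉p⇒x∈∁p v∉S) (x∉p⇒x∈∁p u∉S) (adj-sym a)

  dimensions-meet⇒adj : ∀ {u v} → u ≢ v → All (λ D → Meets (D u) (D v)) dimensions → Adj u v
  dimensions-meet⇒adj {u} {v} u≢v (m₁ ∷ m₂ ∷ stars) = by-cover (u ∈? S) (v ∈? S)
    where
    star-meets : ∀ {x} → x ∈ S → Meets (star G x u) (star G x v)
    star-meets x∈S = All.lookup (All.map⁻ stars) (∈-elements x∈S)

    -- `meet⇒adj` expects the vertex with the smaller left endpoint, the potential parent, first;
    -- the order of `l u` and `l v` decides the roles.
    outside-cover : u ∉ S → v ∉ S → l u ≤ l v ⊎ l v ≤ l u → Adj u v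
    outside-cover u∉S v∉S = Sum.[ (λ lu≤lv → meet⇒adj u∈ v∈ u≢v lu≤lv (proj₂ tours) (proj₂ depths))
                                , (λ lv≤lu → adj-sym (meet⇒adj v∈ u∈ (u≢v ∘ sym) lv≤lu (proj₁ tours) (proj₁ depths))) ]
      where
      tours  = Equivalence.to (tour-meets u∉S v∉S) (universal-on-meets⁻¹ S tour u∉S v∉S m₁)
      depths = universal-on-meets⁻¹ S depth u∉S v∉S m₂
      u∈     = x∉p⇒x∈∁p u∉S
      v∈     = x∉p⇒x∈∁p v∉S

    -- An endpoint in `S` is settled by its own star; otherwise the two forest dimensions decide.
    by-cover : Dec (u ∈ S) → Dec (v ∈ S) → Adj u v
    by-cover (yes u∈S) _         = star-meets⇒adj G u u≢v (star-meets u∈S)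
    by-cover (no _)    (yes v∈S) = adj-sym (star-meets⇒adj G v (u≢v ∘ sym) (swap (star-meets v∈S)))
    by-cover (no u∉S)  (no v∉S)  = outside-cover u∉S v∉S (≤-total (l u) (l v))

theorem18 : ∀ (n : ℕ) (G : Graph (Fin n)) (b m : ℕ) → IsBoxicity G b → IsMFVC G m → b ≤ m + 3
theorem18 n G b m (_ , b-min) ((S , forest , ∣S∣≡m) , _) = ≤-trans
  (b-min (length dims) (boxes dims , boxes-represent G dims λ u v u≢v →
    mk⇔ (adj⇒dimensions-meet G S L u≢v) (dimensions-meet⇒adj G S L u≢v)))
  (≤-trans (≤-reflexive (trans (length-dimensions G S L) (cong (2 +_) ∣S∣≡m)))
           -- The representation has `2 + m` dimensions, one fewer than the bound claimed.
           (≤-trans (n≤1+n (2 + m)) (≤-reflexive (+-comm 3 m))))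
  where
  L    = acyclic⇒layout G _ ≤-refl (forest⇒acyclic G S forest)
  dims = dimensions G S L
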